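{- Let $(S,\mathcal C)$ be a connected connectoid, and for every end $\omega\in\Omega(S,\mathcal C)$ let $X_\omega\subseteq S$ be a finite set; put $\mathcal K^*=\{K(X_\omega,\omega):\omega\in\Omega(S,\mathcal C)\}$. Then there is a rayless normal tree $T$ of $(S,\mathcal C)$ such that every element of $\mathcal K(S\setminus V(T))$ is a subset of some element of $\mathcal K^*$.
   Context: A connectoid is given by a set $S$ and a set $\mathcal F$ of finite subsets of $S$ such that (i) $F\cup F'\in\mathcal F$ whenever $F,F'\in\mathcal F$ and $F\cap F'\neq\emptyset$, and (ii) $\emptyset\in\mathcal F$ and $\{s\}\in\mathcal F$ for every $s\in S$. A set $C\subseteq S$ is connected if for all $x,y\in C$ there is $F\in\mathcal F$ with $F\subseteq C$ and $x,y\in F$; $\mathcal C$ is the set of connected sets and $(S,\mathcal C)$ is the connectoid. It is connected if $S\in\mathcal C$. For $S'\subseteq S$, a component of $S'$ is a maximal connected subset of $S'$, and $\mathcal K(S')$ is the set of components of $S'$. "Almost all" means all but finitely many. A necklace is a connected set $N$ for which there is a family $(H_n)_{n\in\mathbb N}$ of finite connected sets with $N=\bigcup_n H_n$ and $H_i\cap H_j\neq\emptyset$ iff $|i-j|\le 1$. For a necklace $N$ and finite $X\subseteq S$, the $X$-tail of $N$ is the unique element of $\mathcal K(N\setminus X)$ containing almost all elements of $N$. Two necklaces are equivalent if for every finite $X\subseteq S$ their $X$-tails lie in the same element of $\mathcal K(S\setminus X)$. An end is an equivalence class of necklaces; $\Omega(S,\mathcal C)$ is the set of ends; $K(X,\omega)$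 is the element of $\mathcal K(S\setminus X)$ containing the $X$-tails of all necklaces in $\omega$. For a rooted tree $T$ with tree order $\le_T$ and $t\in V(T)$, let $\mathrm{Down}^\circ_T(t)=\{x\in V(T):x<_T t\}$. A weak normal tree of $(S,\mathcal C)$ is a rooted undirected tree $T$ with $V(T)\subseteq S$ such that (1) for every $C\in\mathcal C$ and every two $\le_T$-incomparable $u,v\in C\cap V(T)$ there is $w\in C$ with $w\le_T u$ and $w\le_T v$, and (2) for all $u\le_T v$ in $V(T)$ there is $C\in\mathcal C$ containing $u,v$ with $C\cap\mathrm{Down}^\circ_T(u)=\emptyset$. It is a normal tree if additionally for every rooted ray $R$ of $T$ there is a necklace containing almost all vertices of $R$. A tree is rayless if it contains no ray. -}

module Defs where

open import Level using (Level; suc)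
open import Data.List using (List; []; _∷_; [_]; _++_; length; head; last)
import Data.List.Membership.Propositional as List
open import Data.List.Relation.Binary.BagAndSetEquality using (set; [_]-Equality)
open import Data.List.Relation.Unary.All using (All)
open import Data.List.Relation.Unary.Linked using (Linked)
open import Data.List.Relation.Unary.Unique.Propositional using (Unique)
open import Data.Maybe using (just)
import Data.Nat as ℕ
open import Data.Nat using (ℕ; ∣_-_∣)
open import Data.Product using (Σ; Σ-syntax; ∃; ∃-syntax; _×_; _,_)
open import Function.Bundles using (_⇔_; Func)
open import Function.Definitions using (Injective)
open import Relation.Binary using (Rel; REL; Setoid; Symmetric; Irreflexive; _Respects_; _Respectsˡ_; _Respectsʳ_)
import Relation.Binary.Construct.On as On
open import Relation.Binary.PropositionalEquality using (_≡_; _≢_)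
open import Relation.Nullary using (¬_)
open import Relation.Unary using (Pred; _∈_; _∉_; _⊆_; _≐_; _≬_; _⊥_; _∩_; _∖_; ∁; ⋃; U; Satisfiable)
open import Relation.Unary.Relation.Binary.Equality using (≐-setoid)

-- Zermelo's axiom of choice.  The choice function must respect the setoid
-- equalities: without that requirement the principle is provable, because
-- ∃ carries a witness.
AxiomOfChoice : ∀ a → Set (suc a)
AxiomOfChoice a =
  (A B : Setoid a a) (R : REL (Setoid.Carrier A) (Setoid.Carrier B) a) →
  R Respectsˡ Setoid._≈_ A → R Respectsʳ Setoid._≈_ B →
  (∀ x → ∃[ y ] R x y) →
  Σ[ f ∈ Func A B ] (∀ x → R x (Func.to f x))

-- Subsets of S are predicates on S, compared by _≐_.  Finite subsets are
-- lists, compared by having the same members.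
FiniteSubsets : ∀ {ℓ} → Set ℓ → Setoid ℓ ℓ
FiniteSubsets S = [ set ]-Equality S

module _ {ℓ : Level} {S : Set ℓ} where

  ⟦_⟧ : List S → Pred S ℓ
  ⟦ X ⟧ x = x List.∈ X

  AlmostAll_In_ : ∀ {p q} → Pred S p → Pred S q → Set _
  AlmostAll A In B = Σ[ X ∈ List S ] (A ∖ ⟦ X ⟧) ⊆ B

record Connectoid {ℓ} (S : Set ℓ) : Set (suc ℓ) where
  field
    𝓕        : Pred (List S) ℓ
    𝓕-resp   : 𝓕 Respects Setoid._≈_ (FiniteSubsets S)
    𝓕-union  : ∀ {F F′} → F ∈ 𝓕 → F′ ∈ 𝓕 → ⟦ F ⟧ ≬ ⟦ F′ ⟧ → F ++ F′ ∈ 𝓕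
    𝓕-empty  : [] ∈ 𝓕
    𝓕-single : ∀ s → [ s ] ∈ 𝓕

module _ {ℓ : Level} {S : Set ℓ} where

  record Graph : Set (suc ℓ) where
    field
      V      : Pred S ℓ
      Adj    : Rel S ℓ
      Adj-V  : ∀ {x y} → Adj x y → x ∈ V × y ∈ V
      sym    : Symmetric Adj
      irrefl : Irreflexive _≡_ Adj

    record IsPath (x y : S) (xs : List S) : Set ℓ where
      field
        vertices : All V xs
        distinct : Unique xs
        linked   : Linked Adj xs
        start    : head xs ≡ just x
        end      : last xs ≡ just y

    IsCycle : List S → Set ℓ
    IsCycle xs = ∃[ x ] ∃[ y ] (IsPath x y xs × 3 ℕ.≤ length xs × Adj y x)

    record Ray : Set ℓ where
      field
        vertex    : ℕ → S
        injective : Injective _≡_ _≡_ vertex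
        adjacent  : ∀ n → Adj (vertex n) (vertex (ℕ.suc n))

      vertexSet : Pred S ℓ
      vertexSet x = ∃[ n ] vertex n ≡ x

    Rayless : Set ℓ
    Rayless = ¬ Ray

  record RootedTree : Set (suc ℓ) where
    field
      graph : Graph
    open Graph graph public
    field
      root      : S
      root∈V    : root ∈ V
      connected : ∀ {x y} → x ∈ V → y ∈ V → ∃[ xs ] IsPath x y xs
      acyclic   : ∀ xs → ¬ IsCycle xs

    -- x ≤ y iff x lies on the path from the root to y.
    _≤_ : Rel S ℓ
    x ≤ y = ∃[ xs ] (IsPath root y xs × x List.∈ xs)

    _<_ : Rel S ℓ
    x < y = x ≤ y × x ≢ y

    Incomparable : Rel S ℓ
    Incomparable x y = ¬ (x ≤ y) × ¬ (y ≤ x)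

    Down° : S → Pred S ℓ
    Down° t x = x ∈ V × x < t

    IsRooted : Ray → Set ℓ
    IsRooted R = Ray.vertex R 0 ≡ root

module Theory {ℓ : Level} {S : Set ℓ} (𝒮 : Connectoid S) where
  open Connectoid 𝒮

  -- The family 𝒞.
  Connected : ∀ {p} → Pred S p → Set _
  Connected C = ∀ {x y} → x ∈ C → y ∈ C →
    ∃[ F ] (F ∈ 𝓕 × ⟦ F ⟧ ⊆ C × x ∈ ⟦ F ⟧ × y ∈ ⟦ F ⟧)

  IsConnectedConnectoid : Set ℓ
  IsConnectedConnectoid = Connected U

  -- 𝒦 S′ is the set of components of S′.  The empty set is connected, so
  -- nonemptiness has to be demanded to keep it from being a component of ∅.
  record 𝒦 {p} (S′ : Pred S p) (C : Pred S ℓ) : Set (suc ℓ Level.⊔ p) where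
    field
      nonempty  : Satisfiable C
      connected : Connected C
      inside    : C ⊆ S′
      maximal   : (D : Pred S ℓ) → Connected D → D ⊆ S′ → C ⊆ D → D ⊆ C

  record Necklace : Set (suc ℓ) where
    field
      carrier     : Pred S ℓ
      connected   : Connected carrier
      H           : ℕ → List S
      H-connected : ∀ n → Connected ⟦ H n ⟧
      H-cover     : carrier ≐ ⋃ ℕ (λ n → ⟦ H n ⟧)
      H-meet      : ∀ i j → (⟦ H i ⟧ ≬ ⟦ H j ⟧) ⇔ (∣ i - j ∣ ℕ.≤ 1)

  IsTail : List S → Necklace → Pred S ℓ → Set (suc ℓ)
  IsTail X N C = C ∈ 𝒦 (carrier ∖ ⟦ X ⟧) × AlmostAll carrier In C
    where open Necklace N

  TailIn : List S → Necklace → Pred S ℓ → Set (suc ℓ)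
  TailIn X N K = ∃[ C ] (IsTail X N C × C ⊆ K)

  _≈ₙ_ : Rel Necklace (suc ℓ)
  N ≈ₙ M = ∀ X → ∃[ K ] (K ∈ 𝒦 (∁ ⟦ X ⟧) × TailIn X N K × TailIn X M K)

  record End : Set (suc (suc ℓ)) where
    field
      class   : Pred Necklace (suc ℓ)
      isClass : ∃[ N ] (class ≐ (N ≈ₙ_))

  -- Ends are sets of necklaces, so they are equal when they have the same
  -- elements.
  Ends : Setoid (suc (suc ℓ)) (suc ℓ)
  Ends = On.setoid {B = End} (≐-setoid Necklace (suc ℓ)) End.class

  -- IsK X ω K says that K is the set K(X,ω).
  IsK : List S → End → Pred S ℓ → Set (suc ℓ)
  IsK X ω K = K ∈ 𝒦 (∁ ⟦ X ⟧) × (∀ N → N ∈ End.class ω → TailIn X N K)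

  𝒦* : Func Ends (FiniteSubsets S) → Pred (Pred S ℓ) (suc (suc ℓ))
  𝒦* X K = ∃[ ω ] IsK (Func.to X ω) ω K

  record IsWeakNormal (T : RootedTree {S = S}) : Set (suc ℓ) where
    open RootedTree T
    field
      meet : (C : Pred S ℓ) → Connected C →
        ∀ {u v} → u ∈ C ∩ V → v ∈ C ∩ V → Incomparable u v →
        ∃[ w ] (w ∈ C × w ≤ u × w ≤ v)
      join : ∀ {u v} → u ∈ V → v ∈ V → u ≤ v →
        Σ[ C ∈ Pred S ℓ ] (Connected C × u ∈ C × v ∈ C × C ⊥ Down° u)

  record IsNormal (T : RootedTree {S = S}) : Set (suc ℓ) where
    open RootedTree T
    field
      isWeakNormal : IsWeakNormal T
      rays : (R : Ray) → IsRooted R →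
        Σ[ N ∈ Necklace ] (AlmostAll Ray.vertexSet R In Necklace.carrier N)

{-# OPTIONS --safe #-}
module Submission where

-- A set is decomposable if some element of 𝒦* contains it or if it has a vertex
-- whose deletion leaves decomposable components only.  A decomposition of S is a
-- well-founded tree of deleted vertices, which is rayless and weakly normal, and
-- the pieces it leaves lie in elements of 𝒦*.
--
-- Suppose a connected set is indecomposable.  Deleting finite sets again and
-- again while keeping an indecomposable connected remainder Kₙ, and linking
-- consecutive remainders by finite connected sets, yields a necklace in an end ω.
-- For large n the set Y = X_ω ∩ Kₙ no longer changes, and the component of Kₙ ∖ Y
-- around the tail of the necklace lies in K(X_ω, ω).  In particular ⋂ Kₙ ≠ ∅.
--
-- Call a decomposable component A of K ∖ Z, with Z finite, a fragment of K.  An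
-- infinite chain of fragments with Aᵢ ∪ Zᵢ ⊆ Aᵢ₊₁ would exhaust K, and deleting
-- the Zᵢ one after the other would leave nothing.  Hence maximal fragments (Aₙ, Zₙ)
-- of Kₙ exist for large n.  If Zₙ is deleted from Kₙ and the n-th link contains Zₙ
-- and meets Aₙ, then the fragment around the tail of the necklace contains Aₙ ∪ Zₙ,
-- contradicting maximality.

open import Defs
open import Level using (suc; Lift; lift; lower)
open import Axiom.ExcludedMiddle using (ExcludedMiddle)
open import Data.Empty using (⊥; ⊥-elim; ⊥-elim-irr)
open import Data.List using (List; []; _∷_; [_]; _++_; _∷ʳ_; length; last)
open import Data.List.Membership.Propositional.Properties using (∈-++⁺ˡ; ∈-++⁺ʳ; ∈-++⁻)
open import Data.List.Properties using (∷ʳ-injective; ∷-injective; ++-assoc; ++-identityʳ; length-++)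
open import Data.List.Relation.Unary.All as All using ([]; _∷_)
open import Data.List.Relation.Unary.AllPairs using ([]; _∷_)
open import Data.List.Relation.Unary.Any using (here; there)
open import Data.List.Relation.Unary.Linked using (Linked; []; [-]; _∷_)
open import Data.List.Relation.Unary.Unique.Propositional using (Unique)
open import Data.Maybe using (just)
open import Data.Nat as ℕ using (ℕ; zero; ∣_-_∣; z≤n; s≤s; _+_; _⊔_)
import Data.Nat.Properties as ℕ
open import Data.Product using (Σ; Σ-syntax; ∃; ∃-syntax; _×_; _,_; proj₁; proj₂)
open import Data.Sum using (_⊎_; inj₁; inj₂; [_,_]′)
open import Data.Unit using (⊤; tt)
open import Function.Base using (id; _∘_)
open import Function.Bundles using (Func; mk⇔)
open import Relation.Binary using (Setoid)
open import Relation.Binary.Construct.Closure.ReflexiveTransitive using (Star; ε; _◅_; _◅◅_; reverse)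
open import Relation.Binary.PropositionalEquality
  using (_≡_; _≢_; refl; sym; trans; cong; subst; setoid)
open import Relation.Nullary using (¬_; Dec; yes; no)
open import Relation.Nullary.Decidable using (map′; recompute; decidable-stable)
open import Relation.Unary using (Pred; _∈_; _∉_; _⊆_; _≐_; _≬_; _∩_; _∖_; ∁; ⋃; ｛_｝; Satisfiable)
  renaming (_⊥_ to _⊥ᵖ_)

-- Components as reachability by members of `𝓕`.

module Connectivity {ℓ} {S : Set ℓ} (𝒮 : Connectoid S) where
  open Connectoid 𝒮
  open Theory 𝒮

  -- By union closure, lying in a common member of `𝓕` inside `A` is an equivalence relation on `A`;
  -- this is the class of `x`. For `x` outside `A` it is empty.
  component : Pred S ℓ → S → Pred S ℓ
  component A x y = ∃[ F ] (F ∈ 𝓕 × ⟦ F ⟧ ⊆ A × x ∈ ⟦ F ⟧ × y ∈ ⟦ F ⟧)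

  private variable
    A B : Pred S ℓ
    F : List S
    x y z : S

  𝓕-⊆-component : F ∈ 𝓕 → ⟦ F ⟧ ⊆ A → x ∈ ⟦ F ⟧ → ⟦ F ⟧ ⊆ component A x
  𝓕-⊆-component F∈ F⊆A x∈F y∈F = _ , F∈ , F⊆A , x∈F , y∈F

  component-refl : x ∈ A → x ∈ component A x
  component-refl {x = x} x∈A =
    [ x ] , 𝓕-single x , (λ { (here refl) → x∈A }) , here refl , here refl

  component-sym : y ∈ component A x → x ∈ component A y
  component-sym (F , F∈ , F⊆ , x∈ , y∈) = F , F∈ , F⊆ , y∈ , x∈

  component-trans : y ∈ component A x → z ∈ component A y → z ∈ component A x
  component-trans (F , F∈ , F⊆ , x∈ , y∈) (G , G∈ , G⊆ , y∈′ , z∈) =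
    F ++ G , 𝓕-union F∈ G∈ (_ , y∈ , y∈′) ,
    (λ w∈ → [ F⊆ , G⊆ ]′ (∈-++⁻ F w∈)) , ∈-++⁺ˡ x∈ , ∈-++⁺ʳ F z∈

  component-mono : A ⊆ B → component A x ⊆ component B x
  component-mono A⊆B (F , F∈ , F⊆ , x∈ , y∈) = F , F∈ , A⊆B ∘ F⊆ , x∈ , y∈

  component-⊆ : component A x ⊆ A
  component-⊆ (F , F∈ , F⊆ , x∈ , y∈) = F⊆ y∈

  component-connected : Connected (component A x)
  component-connected y∈ z∈ with component-trans (component-sym y∈) z∈
  ... | F , F∈ , F⊆ , y∈F , z∈F =
    F , F∈ , (λ w∈ → component-trans y∈ (𝓕-⊆-component F∈ F⊆ y∈F w∈)) , y∈F , z∈F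

  connected⇒⊆-component : ∀ {p} {D : Pred S p} → Connected D → D ⊆ A →
                          y ∈ D → y ∈ component A x → D ⊆ component A x
  connected⇒⊆-component conn D⊆A y∈D y∈ z∈D with conn y∈D z∈D
  ... | F , F∈ , F⊆ , y∈F , z∈F =
    component-trans y∈ (𝓕-⊆-component F∈ (D⊆A ∘ F⊆) y∈F z∈F)

  component-𝒦 : x ∈ A → component A x ∈ 𝒦 A
  component-𝒦 {A = A} x∈A = record
    { nonempty  = _ , component-refl x∈A
    ; connected = component-connected
    ; inside    = component-⊆
    ; maximal   = λ D conn D⊆A C⊆D →
        connected⇒⊆-component conn D⊆A (C⊆D (component-refl x∈A)) (component-refl x∈A)
    }

  -- Connect `x` to each listed point of `A` separately. These members of `𝓕` share `x`, so their
  -- union stays in `𝓕`; entries of `Z` outside `A` are skipped.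
  connected-cover : (∀ {P : Set ℓ} → Dec P) → Connected A → x ∈ A → ∀ Z →
    ∃[ F ] (F ∈ 𝓕 × ⟦ F ⟧ ⊆ A × x ∈ ⟦ F ⟧ × (∀ {z} → z ∈ ⟦ Z ⟧ → z ∈ A → z ∈ ⟦ F ⟧))
  connected-cover em conn x∈A [] =
    let F , F∈ , F⊆ , x∈ , _ = component-refl x∈A in F , F∈ , F⊆ , x∈ , λ ()
  connected-cover {A = A} em conn x∈A (z ∷ Z)
    with connected-cover em conn x∈A Z | em {z ∈ A}
  ... | F , F∈ , F⊆ , x∈ , cov | no z∉A =
    F , F∈ , F⊆ , x∈ , λ { (here refl) z∈A → ⊥-elim (z∉A z∈A) ; (there z∈) → cov z∈ }
  ... | F , F∈ , F⊆ , x∈ , cov | yes z∈A with conn x∈A z∈A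
  ... | G , G∈ , G⊆ , x∈G , z∈G =
    F ++ G , 𝓕-union F∈ G∈ (_ , x∈ , x∈G) ,
    (λ w∈ → [ F⊆ , G⊆ ]′ (∈-++⁻ F w∈)) , ∈-++⁺ˡ x∈ ,
    λ { (here refl) _ → ∈-++⁺ʳ F z∈G ; (there w∈) w∈A → ∈-++⁺ˡ (cov w∈ w∈A) }

-- Monotone sequences of sets on a finite list.

module _ {a} {A : Set a} (em : ∀ {P : Set a} → Dec P) where

  -- Each entry of `L` either never enters or has entered by some stage; the maximum of these
  -- finitely many stages works.
  ascending-eventually : (P : ℕ → Pred A a) → (∀ {m n} → m ℕ.≤ n → P m ⊆ P n) →
    ∀ L → ∃[ n ] (∀ {x} → x ∈ ⟦ L ⟧ → ∀ {m} → x ∈ P m → x ∈ P n)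
  ascending-eventually P mono [] = 0 , λ ()
  ascending-eventually P mono (x ∷ L)
    with ascending-eventually P mono L | em {∃[ m ] x ∈ P m}
  ... | n , stable | no never =
    n , λ { (here refl) x∈ → ⊥-elim (never (_ , x∈)) ; (there y∈) → stable y∈ }
  ... | n , stable | yes (m , x∈) = n ⊔ m , λ
    { (here refl) _ → mono (ℕ.m≤n⊔m n m) x∈
    ; (there y∈) y∈P → mono (ℕ.m≤m⊔n n m) (stable y∈ y∈P) }

  descending-eventually : (P : ℕ → Pred A a) → (∀ {m n} → m ℕ.≤ n → P n ⊆ P m) →
    ∀ L → ∃[ n ] (∀ {x} → x ∈ ⟦ L ⟧ → x ∈ P n → ∀ m → x ∈ P m)
  descending-eventually P anti L
    with ascending-eventually (λ n → ∁ (P n)) (λ m≤n x∉ x∈ → x∉ (anti m≤n x∈)) L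
  ... | n , stable = n , λ x∈L x∈n m → decidable-stable em λ x∉m → stable x∈L x∉m x∈n

∣-∣≤1-cases : ∀ i j → ∣ i - j ∣ ℕ.≤ 1 → i ≡ j ⊎ j ≡ ℕ.suc i ⊎ i ≡ ℕ.suc j
∣-∣≤1-cases zero zero _ = inj₁ refl
∣-∣≤1-cases zero (ℕ.suc zero) _ = inj₂ (inj₁ refl)
∣-∣≤1-cases zero (ℕ.suc (ℕ.suc j)) (s≤s ())
∣-∣≤1-cases (ℕ.suc zero) zero _ = inj₂ (inj₂ refl)
∣-∣≤1-cases (ℕ.suc (ℕ.suc i)) zero (s≤s ())
∣-∣≤1-cases (ℕ.suc i) (ℕ.suc j) le with ∣-∣≤1-cases i j le
... | inj₁ refl = inj₁ refl
... | inj₂ (inj₁ refl) = inj₂ (inj₁ refl)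
... | inj₂ (inj₂ refl) = inj₂ (inj₂ refl)

∣-∣≤1-or-apart : ∀ i j → ∣ i - j ∣ ℕ.≤ 1 ⊎ 2 + i ℕ.≤ j ⊎ 2 + j ℕ.≤ i
∣-∣≤1-or-apart zero zero = inj₁ z≤n
∣-∣≤1-or-apart zero (ℕ.suc zero) = inj₁ (s≤s z≤n)
∣-∣≤1-or-apart zero (ℕ.suc (ℕ.suc j)) = inj₂ (inj₁ (s≤s (s≤s z≤n)))
∣-∣≤1-or-apart (ℕ.suc zero) zero = inj₁ (s≤s z≤n)
∣-∣≤1-or-apart (ℕ.suc (ℕ.suc i)) zero = inj₂ (inj₂ (s≤s (s≤s z≤n)))
∣-∣≤1-or-apart (ℕ.suc i) (ℕ.suc j) with ∣-∣≤1-or-apart i j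
... | inj₁ near = inj₁ near
... | inj₂ (inj₁ i≪j) = inj₂ (inj₁ (s≤s i≪j))
... | inj₂ (inj₂ j≪i) = inj₂ (inj₂ (s≤s j≪i))

-- Decomposable sets and the necklace of a run of deletions.

module Decomposition {ℓ} (em : ExcludedMiddle (suc ℓ)) {S : Set ℓ} (𝒮 : Connectoid S)
  (X : Func (Theory.Ends 𝒮) (FiniteSubsets S)) where
  open Connectoid 𝒮
  open Theory 𝒮
  open Connectivity 𝒮

  em₀ : {P : Set ℓ} → Dec P
  em₀ = map′ lower lift em

  endOf : Necklace → End
  endOf N = record { class = N ≈ₙ_ ; isClass = N , id , id }

  -- Ends live in a universe too large for em, so ω is represented by a necklace.
  Captured : Pred S ℓ → Set (suc ℓ)
  Captured C = ∃[ N ] ∃[ K ] (IsK (Func.to X (endOf N)) (endOf N) K × C ⊆ K)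

  -- Irrelevance of the membership proof makes the decomposition of a component
  -- depend on the chosen point x only.
  data Decomposable : Pred S ℓ → Set (suc ℓ) where
    leaf : ∀ {C} → Captured C → Decomposable C
    cut  : ∀ {C} v → v ∈ C →
           (∀ x → .(x ∈ C ∖ ｛ v ｝) → Decomposable (component (C ∖ ｛ v ｝) x)) →
           Decomposable C

  -- Follow the decomposition of `C`, skipping cuts at vertices outside `D`: at such a cut the
  -- connected set `D` stays in one component.
  decomposable-mono : ∀ {C D} → Decomposable C → Connected D → Satisfiable D → D ⊆ C → Decomposable D
  decomposable-mono (leaf (N , K , isK , C⊆K)) conn sat D⊆C = leaf (N , K , isK , C⊆K ∘ D⊆C)
  decomposable-mono {C} {D} (cut v v∈C sub) conn (d , d∈D) D⊆C with em₀ {v ∈ D}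
  ... | yes v∈D = cut v v∈D λ x x∈ →
    decomposable-mono (sub x (D⊆C (proj₁ x∈) , proj₂ x∈)) component-connected
      -- `x∈` is irrelevant here, so a usable proof of membership is recovered by deciding it.
      (x , component-refl (recompute em₀ x∈))
      (component-mono λ { (y∈D , v≢y) → D⊆C y∈D , v≢y })
  ... | no v∉D = decomposable-mono (sub d (D⊆C∖v d∈D)) conn (d , d∈D)
      (connected⇒⊆-component conn D⊆C∖v d∈D (component-refl (D⊆C∖v d∈D)))
    where
    D⊆C∖v : D ⊆ C ∖ ｛ v ｝
    D⊆C∖v x∈D = D⊆C x∈D , λ { refl → v∉D x∈D }

  record Bad (K : Pred S ℓ) : Set (suc ℓ) where
    field
      connected      : Connected K
      point          : S
      point∈         : point ∈ K
      indecomposable : ¬ Decomposable K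

  bad-cut : ∀ {K v} → Bad K → v ∈ K → Σ[ K′ ∈ Pred S ℓ ] (Bad K′ × K′ ⊆ K ∖ ｛ v ｝)
  bad-cut {K} {v} bad v∈K
    with em {Σ[ x ∈ S ] (x ∈ K ∖ ｛ v ｝ × ¬ Decomposable (component (K ∖ ｛ v ｝) x))}
  ... | yes (x , x∈ , indec) =
    component (K ∖ ｛ v ｝) x ,
    record { connected = component-connected ; point∈ = component-refl x∈ ; indecomposable = indec } ,
    component-⊆
  ... | no none = ⊥-elim (Bad.indecomposable bad (cut v v∈K sub))
    where
    sub : ∀ x → .(x ∈ K ∖ ｛ v ｝) → Decomposable (component (K ∖ ｛ v ｝) x)
    sub x x∈ with em {Decomposable (component (K ∖ ｛ v ｝) x)}
    ... | yes dec = dec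
    ... | no indec = ⊥-elim-irr (none (x , x∈ , indec))

  bad-delete : ∀ {K} → Bad K → ∀ Z → Σ[ K′ ∈ Pred S ℓ ] (Bad K′ × K′ ⊆ K ∖ ⟦ Z ⟧)
  bad-delete {K} bad [] = K , bad , λ x∈K → x∈K , λ ()
  bad-delete bad (z ∷ Z) with bad-delete bad Z
  ... | K′ , bad′ , K′⊆ with em₀ {z ∈ K′}
  ... | no z∉K′ = K′ , bad′ , λ x∈ → proj₁ (K′⊆ x∈) ,
    λ { (here refl) → z∉K′ x∈ ; (there x∈Z) → proj₂ (K′⊆ x∈) x∈Z }
  ... | yes z∈K′ with bad-cut bad′ z∈K′
  ... | K″ , bad″ , K″⊆ = K″ , bad″ , λ x∈ → proj₁ (K′⊆ (proj₁ (K″⊆ x∈))) ,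
    λ { (here refl) → proj₂ (K″⊆ x∈) refl ; (there x∈Z) → proj₂ (K′⊆ (proj₁ (K″⊆ x∈))) x∈Z }

  -- link is the most recent link; the remaining region still meets it, in joint.
  record State : Set (suc ℓ) where
    field
      region : Pred S ℓ
      bad    : Bad region
      link   : List S
      link∈  : link ∈ 𝓕
      joint  : S
      joint∈ : joint ∈ ⟦ link ⟧ × joint ∈ region

  -- An infinite play in which stage n deletes the vertices proposed by the
  -- strategy and keeps a bad connected remainder.  Consecutive links share the
  -- joints, and region (2 + n) avoids link n, so the links form a necklace.
  module Run (strategy : ℕ → Pred S ℓ → List S) {K₀ : Pred S ℓ} (bad₀ : Bad K₀) where

    module Step (n : ℕ) (σ : State) where
      open State σ

      remainder : Σ[ K′ ∈ Pred S ℓ ] (Bad K′ × K′ ⊆ region ∖ ⟦ strategy n region ++ link ⟧)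
      remainder = bad-delete bad (strategy n region ++ link)

      exit : S
      exit = Bad.point (proj₁ (proj₂ remainder))

      exit∈ : exit ∈ proj₁ remainder
      exit∈ = Bad.point∈ (proj₁ (proj₂ remainder))

      newLink : ∃[ F ] (F ∈ 𝓕 × ⟦ F ⟧ ⊆ region × joint ∈ ⟦ F ⟧ ×
                  (∀ {z} → z ∈ ⟦ exit ∷ strategy n region ⟧ → z ∈ region → z ∈ ⟦ F ⟧))
      -- `exit` is covered because it becomes the next joint, the proposals because the final
      -- contradiction needs them in the link.
      newLink = connected-cover em₀ (Bad.connected bad) (proj₂ joint∈) (exit ∷ strategy n region)

      next : State
      next = record
        { region = proj₁ remainder
        ; bad    = proj₁ (proj₂ remainder)
        ; link   = proj₁ newLink
        ; link∈  = proj₁ (proj₂ newLink)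
        ; joint  = exit
        ; joint∈ = proj₂ (proj₂ (proj₂ (proj₂ newLink))) (here refl)
                     (proj₁ (proj₂ (proj₂ remainder) exit∈)) , exit∈
        }

    state : ℕ → State
    state zero = record
      { region = K₀ ; bad = bad₀ ; link = [ Bad.point bad₀ ] ; link∈ = 𝓕-single _
      ; joint = Bad.point bad₀ ; joint∈ = here refl , Bad.point∈ bad₀ }
    state (ℕ.suc n) = Step.next n (state n)

    K : ℕ → Pred S ℓ
    K n = State.region (state n)

    bad : ∀ n → Bad (K n)
    bad n = State.bad (state n)

    joint : ℕ → S
    joint n = State.joint (state n)

    -- The shift skips the one-point link of the initial state, so `H n` is built inside `K n` and
    -- deleted on the way to `K (2 + n)`.
    H : ℕ → List S
    H n = State.link (state (ℕ.suc n))

    H∈𝓕 : ∀ n → H n ∈ 𝓕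
    H∈𝓕 n = State.link∈ (state (ℕ.suc n))

    H⊆K : ∀ n → ⟦ H n ⟧ ⊆ K n
    H⊆K n = proj₁ (proj₂ (proj₂ (Step.newLink n (state n))))

    joint∈H : ∀ n → joint n ∈ ⟦ H n ⟧
    joint∈H n = proj₁ (proj₂ (proj₂ (proj₂ (Step.newLink n (state n)))))

    joint∈H′ : ∀ n → joint (ℕ.suc n) ∈ ⟦ H n ⟧
    joint∈H′ n = proj₁ (State.joint∈ (state (ℕ.suc n)))

    strategy∈H : ∀ n {z} → z ∈ ⟦ strategy n (K n) ⟧ → z ∈ K n → z ∈ ⟦ H n ⟧
    strategy∈H n z∈ = proj₂ (proj₂ (proj₂ (proj₂ (Step.newLink n (state n))))) (there z∈)

    K-step : ∀ n → K (ℕ.suc n) ⊆ K n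
    K-step n x∈ = proj₁ (proj₂ (proj₂ (Step.remainder n (state n))) x∈)

    K-avoids-strategy : ∀ n {x} → x ∈ K (ℕ.suc n) → x ∉ ⟦ strategy n (K n) ⟧
    K-avoids-strategy n x∈ x∈Z =
      proj₂ (proj₂ (proj₂ (Step.remainder n (state n))) x∈) (∈-++⁺ˡ x∈Z)

    K-avoids-H : ∀ n {x} → x ∈ K (2 + n) → x ∉ ⟦ H n ⟧
    K-avoids-H n x∈ x∈H =
      proj₂ (proj₂ (proj₂ (Step.remainder (ℕ.suc n) (state (ℕ.suc n)))) x∈)
        (∈-++⁺ʳ (strategy (ℕ.suc n) (K (ℕ.suc n))) x∈H)

    K-anti : ∀ {m n} → m ℕ.≤ n → K n ⊆ K m
    K-anti {m} m≤n = go (ℕ.≤⇒≤′ m≤n)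
      where
      go : ∀ {n} → m ℕ.≤′ n → K n ⊆ K m
      go (ℕ.≤′-reflexive refl) x∈ = x∈
      go (ℕ.≤′-step m≤n) x∈ = go m≤n (K-step _ x∈)

    H-apart : ∀ i j → 2 + i ℕ.≤ j → ¬ (⟦ H i ⟧ ≬ ⟦ H j ⟧)
    H-apart i j i≪j (x , x∈i , x∈j) = K-avoids-H i (K-anti i≪j (H⊆K j x∈j)) x∈i

    joints-linked : ∀ {A : Pred S ℓ} n → (∀ k → ⟦ H (k + n) ⟧ ⊆ A) →
                    ∀ k → joint (k + n) ∈ component A (joint n)
    joints-linked n H⊆A zero = component-refl (H⊆A 0 (joint∈H n))
    joints-linked n H⊆A (ℕ.suc k) = component-trans (joints-linked n H⊆A k)
      (𝓕-⊆-component (H∈𝓕 (k + n)) (H⊆A k) (joint∈H (k + n)) (joint∈H′ (k + n)))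

    carrier : Pred S ℓ
    carrier = ⋃ ℕ (λ n → ⟦ H n ⟧)

    carrier-⊆-component : carrier ⊆ component carrier (joint 0)
    carrier-⊆-component (n , x∈) = component-trans
      (subst (λ m → joint m ∈ component carrier (joint 0)) (ℕ.+-identityʳ n)
        (joints-linked 0 (λ k y∈ → k + 0 , y∈) n))
      (𝓕-⊆-component (H∈𝓕 n) (λ y∈ → n , y∈) (joint∈H n) x∈)

    necklace : Necklace
    necklace = record
      { carrier     = carrier
      ; connected   = λ x∈ y∈ → component-trans
          (component-sym (carrier-⊆-component x∈)) (carrier-⊆-component y∈)
      ; H           = H
      ; H-connected = λ n x∈ y∈ → H n , H∈𝓕 n , id , x∈ , y∈
      ; H-cover     = id , id
      ; H-meet      = λ i j → mk⇔ (near i j) (meet i j)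
      }
      where
      near : ∀ i j → ⟦ H i ⟧ ≬ ⟦ H j ⟧ → ∣ i - j ∣ ℕ.≤ 1
      near i j i≬j@(x , x∈i , x∈j) with ∣-∣≤1-or-apart i j
      ... | inj₁ i~j = i~j
      ... | inj₂ (inj₁ i≪j) = ⊥-elim (H-apart i j i≪j i≬j)
      ... | inj₂ (inj₂ j≪i) = ⊥-elim (H-apart j i j≪i (x , x∈j , x∈i))

      meet : ∀ i j → ∣ i - j ∣ ℕ.≤ 1 → ⟦ H i ⟧ ≬ ⟦ H j ⟧
      meet i j i~j with ∣-∣≤1-cases i j i~j
      ... | inj₁ refl = joint i , joint∈H i , joint∈H i
      ... | inj₂ (inj₁ refl) = joint j , joint∈H′ i , joint∈H j
      ... | inj₂ (inj₂ refl) = joint i , joint∈H i , joint∈H′ j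

    -- The entries of `L` present at stage `k` are never removed, whereas each joint lies in a link
    -- and is gone two stages later.
    joints-escape : ∀ L n → ∃[ k ] joint (k + n) ∉ ⟦ L ⟧
    joints-escape L n with descending-eventually em₀ K K-anti L
    ... | k , stable = k , λ j∈L → K-avoids-H (k + n)
      (stable j∈L (K-anti (ℕ.m≤m+n k n) (H⊆K (k + n) (joint∈H (k + n)))) (2 + (k + n)))
      (joint∈H (k + n))

    Xω : List S
    Xω = Func.to X (endOf necklace)

    stage : ℕ
    stage = proj₁ (descending-eventually em₀ K K-anti Xω)

    Xω-stable : ∀ {x} → x ∈ ⟦ Xω ⟧ → x ∈ K stage → ∀ m → x ∈ K m
    Xω-stable = proj₂ (descending-eventually em₀ K K-anti Xω)

    -- A vertex of `Xω` in `K stage` survives all stages, while every vertex of a link is eventually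
    -- deleted.
    tail⊆ : ∀ k → ⟦ H (k + stage) ⟧ ⊆ K stage ∖ ⟦ Xω ⟧
    tail⊆ k x∈ = x∈K , λ x∈X → K-avoids-H (k + stage) (Xω-stable x∈X x∈K (2 + (k + stage))) x∈
      where x∈K = K-anti (ℕ.m≤n+m stage k) (H⊆K (k + stage) x∈)

    limit : Pred S ℓ
    limit = component (K stage ∖ ⟦ Xω ⟧) (joint stage)

    H⊆limit : ⟦ H stage ⟧ ⊆ limit
    H⊆limit = 𝓕-⊆-component (H∈𝓕 stage) (tail⊆ 0) (joint∈H stage)

    limit-decomposable : Decomposable limit
    limit-decomposable = leaf (necklace , around , (around∈𝒦 , captures) , component-mono proj₂)
      where
      around : Pred S ℓ
      around = component (∁ ⟦ Xω ⟧) (joint stage)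

      around∈𝒦 : around ∈ 𝒦 (∁ ⟦ Xω ⟧)
      around∈𝒦 = component-𝒦 (proj₂ (tail⊆ 0 (joint∈H stage)))

      -- By equivalence the `Xω`-tails of both necklaces lie in one component `K′`. A joint outside
      -- the exceptional list `L` lies in both `K′` and `around`, so `K′ ⊆ around`.
      captures : ∀ N → necklace ≈ₙ N → TailIn Xω N around
      captures N necklace≈N with necklace≈N Xω
      ... | K′ , K′∈𝒦 , (C , (C∈𝒦 , L , cofinite) , C⊆K′) , (C′ , isTail , C′⊆K′) =
        C′ , isTail , K′⊆around ∘ C′⊆K′
        where
        k = proj₁ (joints-escape L stage)

        K′⊆around : K′ ⊆ around
        K′⊆around = connected⇒⊆-component (𝒦.connected K′∈𝒦) (𝒦.inside K′∈𝒦)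
          (C⊆K′ (cofinite ((k + stage , joint∈H (k + stage)) , proj₂ (joints-escape L stage))))
          (joints-linked stage (λ m → proj₂ ∘ tail⊆ m) k)

    -- If every vertex is eventually removed, no vertex of `Xω` is left at `stage`, so the bad set
    -- `K stage` lies inside the decomposable `limit`.
    not-vanishing : (∀ x → ∃[ m ] x ∉ K m) → ⊥
    not-vanishing vanish = Bad.indecomposable (bad stage)
      (decomposable-mono limit-decomposable (Bad.connected (bad stage))
        (_ , Bad.point∈ (bad stage))
        (connected⇒⊆-component (Bad.connected (bad stage))
          (λ x∈ → x∈ , λ x∈X → proj₂ (vanish _) (Xω-stable x∈X x∈ (proj₁ (vanish _))))
          (proj₂ (State.joint∈ (state stage)))
          (component-refl (tail⊆ 0 (joint∈H stage)))))

  -- Fragments, their maximality, and the absence of bad sets.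

  record Fragment (K : Pred S ℓ) : Set (suc ℓ) where
    field
      boundary : List S
      base     : S
      base∈    : base ∈ K ∖ ⟦ boundary ⟧

    piece : Pred S ℓ
    piece = component (K ∖ ⟦ boundary ⟧) base

    field
      decomposable : Decomposable piece

  open Fragment

  -- Swallowing the boundary is what makes an ascending chain exhaust `K`. Only its vertices in `K`
  -- count, as `boundary` may list others.
  _⊏_ : ∀ {K} → Fragment K → Fragment K → Set ℓ
  _⊏_ {K} P Q = piece P ⊆ piece Q × K ∩ ⟦ boundary P ⟧ ⊆ piece Q

  -- A connected set that avoids the boundary and meets the piece lies inside it and would inherit
  -- its decomposability.
  bad-avoids-piece : ∀ {K D} (P : Fragment K) → Bad D → D ⊆ K ∖ ⟦ boundary P ⟧ →
                     ∀ {x} → x ∈ piece P → x ∉ D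
  bad-avoids-piece P bad D⊆ x∈P x∈D = Bad.indecomposable bad
    (decomposable-mono (decomposable P) (Bad.connected bad) (_ , x∈D)
      (connected⇒⊆-component (Bad.connected bad) D⊆ x∈D x∈P))

  no-ascending-chain : ∀ {K} → Bad K → (P : ℕ → Fragment K) → (∀ n → P n ⊏ P (ℕ.suc n)) → ⊥
  no-ascending-chain {K} badK P asc = R.not-vanishing λ x → vanish x
    where
    module R = Run (λ n _ → boundary (P n)) badK

    piece-mono : ∀ {m n} → m ℕ.≤ n → piece (P m) ⊆ piece (P n)
    piece-mono {m} m≤n = go (ℕ.≤⇒≤′ m≤n)
      where
      go : ∀ {n} → m ℕ.≤′ n → piece (P m) ⊆ piece (P n)
      go (ℕ.≤′-reflexive refl) x∈ = x∈
      go (ℕ.≤′-step m≤n) x∈ = proj₁ (asc _) (go m≤n x∈)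

    -- Some `F` in `𝓕` joins `x` to the first base. Once the pieces gain no more points of `F`, a
    -- point of `F` on the boundary of `P n` would lie in the next piece, hence already in that of
    -- `P n`, which avoids this boundary. So `F` lies in the piece of `P n`.
    exhaust : ∀ {x} → x ∈ K → ∃[ n ] x ∈ piece (P n)
    exhaust x∈K with Bad.connected badK (proj₁ (base∈ (P 0))) x∈K
    ... | F , F∈ , F⊆K , base∈F , x∈F with ascending-eventually em₀ (λ n → piece (P n)) piece-mono F
    ... | n , stable = n , component-trans (piece-mono {0} z≤n (component-refl (base∈ (P 0))))
        (𝓕-⊆-component F∈ F⊆ base∈F x∈F)
      where
      F⊆ : ⟦ F ⟧ ⊆ K ∖ ⟦ boundary (P n) ⟧
      F⊆ y∈F = F⊆K y∈F , λ y∈∂ →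
        proj₂ (component-⊆ (stable y∈F {ℕ.suc n} (proj₂ (asc n) (F⊆K y∈F , y∈∂)))) y∈∂

    vanish : ∀ x → ∃[ m ] x ∉ R.K m
    vanish x with em₀ {x ∈ K}
    ... | no x∉K = 0 , x∉K
    ... | yes x∈K with exhaust x∈K
    ... | n , x∈P = ℕ.suc n , bad-avoids-piece (P n) (R.bad (ℕ.suc n))
      (λ y∈ → R.K-anti {n = n} z≤n (R.K-step n y∈) , R.K-avoids-strategy n y∈) x∈P

  Maximal : ∀ {K} → Fragment K → Set (suc ℓ)
  Maximal {K} P = ∀ Q → ¬ (P ⊏ Q)

  maximal-fragment : ∀ {K} → Bad K → Fragment K → Σ (Fragment K) Maximal
  maximal-fragment {K} badK P₀ with em {Σ (Fragment K) Maximal}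
  ... | yes maximal = maximal
  ... | no none = ⊥-elim (no-ascending-chain badK chain (λ n → proj₂ (above (chain n))))
    where
    above : ∀ P → ∃[ Q ] P ⊏ Q
    above P = decidable-stable em λ ¬above → none (P , λ Q P⊏Q → ¬above (Q , P⊏Q))

    chain : ℕ → Fragment K
    chain zero = P₀
    chain (ℕ.suc n) = proj₁ (above (chain n))

  ¬bad : ∀ {K} → ¬ Bad K
  ¬bad bad₀ = contradictory em refl
    where
    -- Including `base P` makes the link meet the piece of `P`.
    proposal : ∀ {K} → Dec (Σ (Fragment K) Maximal) → List S
    proposal (yes (P , _)) = base P ∷ boundary P
    proposal (no _) = []

    module R = Run (λ _ K → proposal (em {Σ (Fragment K) Maximal})) bad₀
    open R using (stage; Xω)

    limitFragment : Fragment (R.K stage)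
    limitFragment = record
      { boundary = Xω ; base = R.joint stage
      ; base∈ = R.tail⊆ 0 (R.joint∈H stage) ; decomposable = R.limit-decomposable }

    -- Abstracting the decision as `d` permits case analysis; `d ≡ em` records that `P` is the very
    -- fragment proposed at `stage`.
    contradictory : (d : Dec (Σ (Fragment (R.K stage)) Maximal)) → d ≡ em → ⊥
    contradictory (no none) _ = none (maximal-fragment (R.bad stage) limitFragment)
    contradictory (yes (P , maximal)) d≡em = maximal limitFragment
      ( connected⇒⊆-component component-connected piece⊆ (component-refl (base∈ P))
          (played⊆limit (here refl) (proj₁ (base∈ P)))
      , λ { (x∈K , x∈∂) → played⊆limit (there x∈∂) x∈K } )
      where
      played : ∀ {x} → x ∈ ⟦ base P ∷ boundary P ⟧ → x ∈ ⟦ proposal em ⟧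
      played = subst (λ d → _ ∈ ⟦ proposal d ⟧) d≡em

      played⊆limit : ∀ {x} → x ∈ ⟦ base P ∷ boundary P ⟧ → x ∈ R.K stage → x ∈ R.limit
      played⊆limit x∈ x∈K = R.H⊆limit (R.strategy∈H stage (played x∈) x∈K)

      -- The next bad region avoids the boundary of `P`, hence also its piece, whereas vertices of
      -- `Xω` in `K stage` survive into that region.
      piece⊆ : piece P ⊆ R.K stage ∖ ⟦ Xω ⟧
      piece⊆ x∈P = proj₁ (component-⊆ x∈P) , λ x∈X →
        bad-avoids-piece P (R.bad (ℕ.suc stage))
          (λ y∈ → R.K-step stage y∈ , λ y∈∂ → R.K-avoids-strategy stage y∈ (played (there y∈∂)))
          x∈P (R.Xω-stable x∈X (proj₁ (component-⊆ x∈P)) (ℕ.suc stage))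

  decomposable-if-connected : ∀ {C} → Connected C → Satisfiable C → Decomposable C
  decomposable-if-connected conn (x , x∈) = decidable-stable em λ indec →
    ¬bad record { connected = conn ; point∈ = x∈ ; indecomposable = indec }

-- Rooted trees from root paths.

last∈ : ∀ {a} {A : Set a} {x : A} xs → last xs ≡ just x → x ∈ ⟦ xs ⟧
last∈ (x ∷ []) refl = here refl
last∈ (x ∷ y ∷ xs) eq = there (last∈ (y ∷ xs) eq)

[-]≢∷ʳ : ∀ {a} {A : Set a} {x y z : A} ts → y ∈ ⟦ ts ⟧ → [ x ] ≢ ts ∷ʳ z
[-]≢∷ʳ (_ ∷ []) _ ()
[-]≢∷ʳ (_ ∷ _ ∷ _) _ ()

-- A rooted tree given by the sequence of vertices on the path from the root to
-- each vertex.
module TraceTree {ℓ} {S : Set ℓ} (em : ∀ {P : Set ℓ} → Dec P)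
  (V : Pred S ℓ) (trace : S → List S) (root : S) (root∈V : root ∈ V)
  (trace-root : trace root ≡ [ root ])
  (parent : ∀ {x} → x ∈ V → x ≡ root ⊎ ∃[ y ] (y ∈ V × trace x ≡ trace y ∷ʳ x)) where

  Child : S → S → Set ℓ
  Child x y = trace y ≡ trace x ∷ʳ y

  depth : S → ℕ
  depth x = length (trace x)

  depth-child : ∀ {x y} → Child x y → depth y ≡ ℕ.suc (depth x)
  depth-child {x} child =
    trans (cong length child) (trans (length-++ (trace x)) (ℕ.+-comm (depth x) 1))

  trace-last : ∀ {x} → x ∈ V → ∃[ ts ] trace x ≡ ts ∷ʳ x
  trace-last x∈V with parent x∈V
  ... | inj₁ refl = [] , trace-root
  ... | inj₂ (y , _ , child) = trace y , child

  -- Removing the last entry from the trace of `z` leaves the trace of its parent, which ends in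
  -- that parent.
  child-injective : ∀ {x y z} → x ∈ V → y ∈ V → Child x z → Child y z → x ≡ y
  child-injective {x} {y} x∈V y∈V xz yz with trace-last x∈V | trace-last y∈V
  ... | ts , tx | us , ty = proj₂ (∷ʳ-injective ts us
    (trans (sym tx) (trans (proj₁ (∷ʳ-injective (trace x) (trace y) (trans (sym xz) yz))) ty)))

  root-no-parent : ∀ {x} → x ∈ V → ¬ Child x root
  root-no-parent {x} x∈V child with trace-last x∈V
  ... | ts , tx = [-]≢∷ʳ (trace x) (subst (λ us → x ∈ ⟦ us ⟧) (sym tx) (∈-++⁺ʳ ts (here refl)))
    (trans (sym trace-root) child)

  Adj : S → S → Set ℓ
  Adj x y = x ∈ V × y ∈ V × (Child x y ⊎ Child y x)

  Adj-sym : ∀ {x y} → Adj x y → Adj y x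
  Adj-sym (x∈V , y∈V , inj₁ xy) = y∈V , x∈V , inj₂ xy
  Adj-sym (x∈V , y∈V , inj₂ yx) = y∈V , x∈V , inj₁ yx

  graph : Graph {S = S}
  graph = record
    { V = V ; Adj = Adj ; Adj-V = λ { (x∈V , y∈V , _) → x∈V , y∈V } ; sym = Adj-sym
    ; irrefl = λ { refl (_ , _ , inj₁ xx) → ℕ.1+n≢n (sym (depth-child xx))
                 ; refl (_ , _ , inj₂ xx) → ℕ.1+n≢n (sym (depth-child xx)) } }

  open Graph graph using (IsPath; IsCycle; Ray; Rayless)

  suffix-path : ∀ {w x y xs} → IsPath w y xs → x ∈ ⟦ xs ⟧ → ∃[ ys ] IsPath x y ys
  suffix-path {xs = x ∷ xs} record { vertices = vs ; distinct = ds ; linked = ls ; end = e } (here refl) =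
    x ∷ xs , record { vertices = vs ; distinct = ds ; linked = ls ; start = refl ; end = e }
  suffix-path {xs = _ ∷ _ ∷ _}
    record { vertices = _ ∷ vs ; distinct = _ ∷ ds ; linked = _ ∷ ls ; end = e } (there x∈) =
    suffix-path record { vertices = vs ; distinct = ds ; linked = ls ; start = refl ; end = e } x∈

  -- Loop erasure: if `x` already occurs on the path found, only the part from `x` on is kept.
  walk⇒path : ∀ {x y} → x ∈ V → Star Adj x y → ∃[ xs ] IsPath x y xs
  walk⇒path {x} x∈V ε = [ x ] , record
    { vertices = x∈V ∷ [] ; distinct = [] ∷ [] ; linked = [-] ; start = refl ; end = refl }
  walk⇒path {x} x∈V (xz ◅ walk) with walk⇒path (proj₁ (proj₂ xz)) walk
  ... | xs , path with em {x ∈ ⟦ xs ⟧}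
  ... | yes x∈xs = suffix-path path x∈xs
  walk⇒path {x} x∈V (xz ◅ walk)
    | (z ∷ xs) , record { vertices = vs ; distinct = ds ; linked = ls ; start = refl ; end = e } | no x∉xs =
    x ∷ z ∷ xs , record
      { vertices = x∈V ∷ vs
      ; distinct = All.tabulate (λ { y∈ refl → x∉xs y∈ }) ∷ ds
      ; linked = xz ∷ ls ; start = refl ; end = e }

  walk-from-root : ∀ n {x} → x ∈ V → depth x ℕ.≤ n → Star Adj root x
  walk-from-root n x∈V d≤n with parent x∈V
  ... | inj₁ refl = ε
  walk-from-root zero x∈V d≤n | inj₂ (y , y∈V , yx) with subst (ℕ._≤ 0) (depth-child yx) d≤n
  ... | ()
  walk-from-root (ℕ.suc n) x∈V d≤n | inj₂ (y , y∈V , yx) =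
    walk-from-root n y∈V (ℕ.≤-pred (subst (ℕ._≤ ℕ.suc n) (depth-child yx) d≤n))
      ◅◅ ((y∈V , x∈V , inj₁ yx) ◅ ε)

  path-between : ∀ {x y} → x ∈ V → y ∈ V → ∃[ xs ] IsPath x y xs
  path-between x∈V y∈V = walk⇒path x∈V
    (reverse Adj-sym (walk-from-root _ x∈V ℕ.≤-refl) ◅◅ walk-from-root _ y∈V ℕ.≤-refl)

  -- A path that has left a vertex for one of its children cannot turn back,
  -- since a vertex has only one parent.
  descending : ∀ {x y xs} → Child x y → Linked Adj (x ∷ y ∷ xs) → Unique (x ∷ y ∷ xs) →
               Linked Child (x ∷ y ∷ xs)
  descending {xs = []} xy _ _ = xy ∷ [-]
  descending {xs = z ∷ xs} xy (_ ∷ ls@((_ , _ , inj₁ yz) ∷ _)) (_ ∷ ds) =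
    xy ∷ descending yz ls ds
  descending {xs = z ∷ xs} xy ((x∈V , _) ∷ (_ , z∈V , inj₂ zy) ∷ _) ((_ ∷ x≢z ∷ _) ∷ _) =
    ⊥-elim (x≢z (child-injective x∈V z∈V xy zy))

  trace-descending : ∀ {x y} xs → Linked Child (x ∷ xs) → last (x ∷ xs) ≡ just y →
                     trace y ≡ trace x ++ xs
  trace-descending [] _ refl = sym (++-identityʳ _)
  trace-descending {x} (z ∷ xs) (xz ∷ ls) e = trans (trace-descending xs ls e)
    (trans (cong (_++ xs) xz) (++-assoc (trace x) [ z ] xs))

  depth-descending : ∀ {x y} xs → Linked Child (x ∷ xs) → last (x ∷ xs) ≡ just y →
                     depth y ≡ depth x + length xs
  depth-descending {x} xs ls e = trans (cong length (trace-descending xs ls e)) (length-++ (trace x))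

  descending-last : ∀ {x y z} xs → Linked Child (x ∷ z ∷ xs) → last (z ∷ xs) ≡ just y →
                    ∃[ w ] (w ∈ ⟦ x ∷ z ∷ xs ⟧ × Child w y)
  descending-last [] (xz ∷ _) refl = _ , here refl , xz
  descending-last (_ ∷ xs) (_ ∷ ls) e with descending-last xs ls e
  ... | w , w∈ , wy = w , there w∈ , wy

  -- After its first downward step a path only descends, so it either climbs throughout or ends with
  -- a downward step.
  ascending-or-last-down : ∀ {x y} xs → Linked Adj (x ∷ xs) → Unique (x ∷ xs) → last (x ∷ xs) ≡ just y →
    depth y ℕ.≤ depth x ⊎ ∃[ w ] (w ∈ ⟦ x ∷ xs ⟧ × Child w y)
  ascending-or-last-down [] _ _ refl = inj₁ ℕ.≤-refl
  ascending-or-last-down (z ∷ xs) ls@((_ , _ , inj₁ xz) ∷ _) ds e =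
    inj₂ (descending-last xs (descending xz ls ds) e)
  ascending-or-last-down (z ∷ xs) ((_ , _ , inj₂ zx) ∷ ls) (_ ∷ ds) e with ascending-or-last-down xs ls ds e
  ... | inj₁ y≤z = inj₁ (ℕ.≤-trans y≤z (subst (_ ℕ.≤_) (sym (depth-child zx)) (ℕ.n≤1+n _)))
  ... | inj₂ (w , w∈ , wy) = inj₂ (w , there w∈ , wy)

  acyclic : ∀ xs → ¬ IsCycle xs
  acyclic [] (_ , _ , _ , () , _)
  acyclic (_ ∷ []) (_ , _ , _ , s≤s () , _)
  acyclic (_ ∷ _ ∷ []) (_ , _ , _ , s≤s (s≤s ()) , _)
  -- First step down: the whole path descends, so its ends differ in depth by at least two and
  -- cannot be adjacent.
  acyclic (x ∷ x′ ∷ x″ ∷ xs)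
    (_ , y , record { distinct = ds ; linked = ls@((_ , _ , inj₁ xx′) ∷ _) ; start = refl ; end = e } ,
     _ , y∈V , _ , y~x) = [ yx , xy ]′ y~x
    where
    y≫x : depth y ≡ depth x + (2 + length xs)
    y≫x = depth-descending _ (descending xx′ ls ds) e
    yx : ¬ Child y x
    yx c = ℕ.<⇒≱ (subst (depth y ℕ.<_) (sym (depth-child c)) ℕ.≤-refl)
      (subst (depth x ℕ.≤_) (sym y≫x) (ℕ.m≤m+n _ _))
    xy : ¬ Child x y
    xy c with ℕ.+-cancelˡ-≡ (depth x) 1 (2 + length xs)
              (trans (ℕ.+-comm (depth x) 1) (trans (sym (depth-child c)) y≫x))
    ... | ()
  -- First step up, `y` the parent of `x`: then `x′` and `y` are the same parent, but the path has
  -- them distinct.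
  acyclic (x ∷ x′ ∷ x″ ∷ xs)
    (_ , y , record { distinct = ds@((_ ∷ x∉) ∷ x′∉ ∷ _) ; linked = (x∈V , x′∈V , inj₂ x′x) ∷ ls
                    ; start = refl ; end = e } , _ , y∈V , _ , inj₁ yx) =
    All.lookup x′∉ (last∈ (x″ ∷ xs) e) (child-injective x′∈V y∈V x′x yx)
  -- First step up, `y` a child of `x`: `y` is too deep for a path that only climbs, and a last step
  -- down into `y` would have to start at `x`, which is not revisited.
  acyclic (x ∷ x′ ∷ x″ ∷ xs)
    (_ , y , record { vertices = _ ∷ vs ; distinct = x∉ ∷ ds ; linked = (x∈V , x′∈V , inj₂ x′x) ∷ ls
                    ; start = refl ; end = e } , _ , y∈V , _ , inj₂ xy)
    with ascending-or-last-down (x″ ∷ xs) ls ds e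
  ... | inj₁ y≤x′ = ℕ.<⇒≱
    (subst (depth x′ ℕ.<_) (sym (trans (depth-child xy) (cong ℕ.suc (depth-child x′x)))) (ℕ.m≤n⇒m≤1+n ℕ.≤-refl))
    y≤x′
  ... | inj₂ (w , w∈ , wy) = All.lookup x∉ w∈ (child-injective x∈V (All.lookup vs w∈) xy wy)

  tree : RootedTree {S = S}
  tree = record
    { graph = graph ; root = root ; root∈V = root∈V ; connected = path-between ; acyclic = acyclic }

  open RootedTree tree using (_≤_)

  -- The root has no parent, so the path starts downwards and keeps descending. This turns the tree
  -- order into membership in traces.
  root-path : ∀ {y xs} → IsPath root y xs → xs ≡ trace y
  root-path {xs = _ ∷ []} record { start = refl ; end = refl } = sym trace-root
  root-path {xs = _ ∷ z ∷ xs} record { distinct = ds ; linked = ls@((_ , _ , inj₁ rz) ∷ _) ; start = refl ; end = e } =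
    sym (trans (trace-descending (z ∷ xs) (descending rz ls ds) e) (cong (_++ z ∷ xs) trace-root))
  root-path {xs = _ ∷ _ ∷ _} record { linked = (_ , z∈V , inj₂ zr) ∷ _ ; start = refl } =
    ⊥-elim (root-no-parent z∈V zr)

  ≤⇒∈trace : ∀ {x y} → x ≤ y → x ∈ ⟦ trace y ⟧
  ≤⇒∈trace (xs , path , x∈) = subst (λ ts → _ ∈ ⟦ ts ⟧) (root-path path) x∈

  ∈trace⇒≤ : ∀ {x y} → y ∈ V → x ∈ ⟦ trace y ⟧ → x ≤ y
  ∈trace⇒≤ y∈V x∈ with path-between root∈V y∈V
  ... | xs , path = xs , path , subst (λ ts → _ ∈ ⟦ ts ⟧) (sym (root-path path)) x∈

  -- Depth bounds the number of initial upward steps, and turning back after a downward step would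
  -- revisit the parent. So every ray has a tail that is a sequence of children.
  rayless : (∀ (x : ℕ → S) → (∀ n → x n ∈ V) → ¬ (∀ n → Child (x n) (x (ℕ.suc n)))) → Rayless
  rayless wf R = wf (λ n → vertex (n + proj₁ turn)) (λ n → proj₁ (adjacent _)) eventually
    where
    open Ray R

    find : ∀ d n → depth (vertex n) ℕ.≤ d → ∃[ k ] Child (vertex k) (vertex (ℕ.suc k))
    find d n d≤ with adjacent n
    ... | _ , _ , inj₁ down = n , down
    find zero n d≤ | _ , _ , inj₂ up with subst (ℕ._≤ 0) (depth-child up) d≤
    ... | ()
    find (ℕ.suc d) n d≤ | _ , _ , inj₂ up =
      find d (ℕ.suc n) (ℕ.≤-pred (subst (ℕ._≤ ℕ.suc d) (depth-child up) d≤))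

    turn = find _ 0 ℕ.≤-refl

    continue : ∀ k → Child (vertex k) (vertex (ℕ.suc k)) →
               Child (vertex (ℕ.suc k)) (vertex (ℕ.suc (ℕ.suc k)))
    continue k down with adjacent (ℕ.suc k)
    ... | _ , _ , inj₁ down′ = down′
    ... | _ , z∈V , inj₂ up
      with injective (child-injective (proj₁ (adjacent k)) z∈V down up)
    ... | ()

    eventually : ∀ n → Child (vertex (n + proj₁ turn)) (vertex (ℕ.suc n + proj₁ turn))
    eventually zero = proj₂ turn
    eventually (ℕ.suc n) = continue _ (eventually n)

-- The tree of a decomposition.

module NormalTree {ℓ} (em : ExcludedMiddle (suc ℓ)) (ac : AxiomOfChoice (suc ℓ))
  {S : Set ℓ} (𝒮 : Connectoid S) (s₀ : S)
  (X : Func (Theory.Ends 𝒮) (FiniteSubsets S)) where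
  open Connectoid 𝒮
  open Theory 𝒮
  open Connectivity 𝒮
  open Decomposition em 𝒮 X

  private
    Subsets : Setoid (suc ℓ) (suc ℓ)
    Subsets = record
      { Carrier = Pred S ℓ
      ; _≈_ = λ P Q → Lift (suc ℓ) (P ≐ Q)
      ; isEquivalence = record
        { refl  = lift (id , id)
        ; sym   = λ { (lift (f , g)) → lift (g , f) }
        ; trans = λ { (lift (f , g)) (lift (h , k)) → lift (h ∘ f , g ∘ k) } } }

    -- Respecting extensional equality of subsets is what makes `rep` constant on components.
    choice : Σ[ f ∈ Func Subsets (setoid (Lift (suc ℓ) S)) ]
             (∀ P → Lift (suc ℓ) (Satisfiable P → lower (Func.to f P) ∈ P))
    choice = ac Subsets (setoid (Lift (suc ℓ) S)) (λ P s → Lift (suc ℓ) (Satisfiable P → lower s ∈ P))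
      (λ { (lift (f , g)) (lift r) → lift λ { (x , x∈) → f (r (x , g x∈)) } })
      (λ { refl r → r })
      pick
      where
      pick : ∀ P → ∃[ s ] Lift (suc ℓ) (Satisfiable P → lower s ∈ P)
      pick P with em₀ {Satisfiable P}
      ... | yes (x , x∈) = lift x , lift λ _ → x∈
      -- The value `s₀` only makes the relation total; for empty `P` the implication is vacuous.
      ... | no empty = lift s₀ , lift λ sat → ⊥-elim (empty sat)

  -- One point per component, so that all its points follow the same decomposition.
  rep : Pred S ℓ → S → S
  rep A x = lower (Func.to (proj₁ choice) (component A x))

  rep∈component : ∀ A {x} → x ∈ A → rep A x ∈ component A x
  rep∈component A {x} x∈A = lower (proj₂ choice (component A x)) (x , component-refl x∈A)

  rep∈ : ∀ A {x} → x ∈ A → rep A x ∈ A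
  rep∈ A x∈A = component-⊆ (rep∈component A x∈A)

  rep-cong : ∀ {A x y} → y ∈ component A x → rep A y ≡ rep A x
  rep-cong y∈ = cong lower (Func.cong (proj₁ choice)
    (lift (component-trans y∈ , component-trans (component-sym y∈))))

  ∈component-rep : ∀ A {x} → x ∈ A → x ∈ component A (rep A x)
  ∈component-rep A x∈A = component-sym (rep∈component A x∈A)

  -- The vertices deleted on the way to x, ending in x itself if x is deleted.
  trace : ∀ {C} → Decomposable C → S → List S
  trace (leaf _) x = []
  trace {C} (cut v _ sub) x with em₀ {x ∈ C ∖ ｛ v ｝}
  ... | yes x∈ = v ∷ trace (sub _ (rep∈ (C ∖ ｛ v ｝) x∈)) x
  ... | no _ = [ v ]

  Vertex : ∀ {C} → Decomposable C → Pred S ℓ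
  Vertex g x = x ∈ ⟦ trace g x ⟧

  module _ {C : Pred S ℓ} {v : S} (v∈C : v ∈ C)
    (sub : ∀ x → .(x ∈ C ∖ ｛ v ｝) → Decomposable (component (C ∖ ｛ v ｝) x)) where

    below : ∀ {x} → x ∈ C ∖ ｛ v ｝ → Decomposable (component (C ∖ ｛ v ｝) (rep (C ∖ ｛ v ｝) x))
    below x∈ = sub _ (rep∈ (C ∖ ｛ v ｝) x∈)

    trace-cut : trace (cut v v∈C sub) v ≡ [ v ]
    trace-cut with em₀ {v ∈ C ∖ ｛ v ｝}
    ... | yes (_ , v≢v) = ⊥-elim (v≢v refl)
    ... | no _ = refl

    -- `x` and `y` have equal representatives, and as `sub` ignores the membership proof, both are
    -- sent to the same decomposition.
    trace-below : ∀ {x y} (x∈ : x ∈ C ∖ ｛ v ｝) → y ∈ component (C ∖ ｛ v ｝) x →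
                  trace (cut v v∈C sub) y ≡ v ∷ trace (below x∈) y
    trace-below {x} {y} x∈ y∈x with em₀ {y ∈ C ∖ ｛ v ｝}
    ... | no y∉ = ⊥-elim (y∉ (component-⊆ y∈x))
    ... | yes y∈ = cong (v ∷_) (same (rep∈ (C ∖ ｛ v ｝) y∈) (rep∈ (C ∖ ｛ v ｝) x∈) (rep-cong y∈x))
      where
      same : ∀ {a b} .(a∈ : a ∈ C ∖ ｛ v ｝) .(b∈ : b ∈ C ∖ ｛ v ｝) → a ≡ b →
             trace (sub a a∈) y ≡ trace (sub b b∈) y
      same {a} a∈ _ refl = refl {x = trace (sub a a∈) y}

    cut-cases : ∀ {x} → x ∈ C → v ≡ x ⊎ x ∈ C ∖ ｛ v ｝
    cut-cases {x} x∈C with em₀ {v ≡ x}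
    ... | yes v≡x = inj₁ v≡x
    ... | no v≢x = inj₂ (x∈C , v≢x)

    ∈trace-below : ∀ {x y z} (x∈ : x ∈ C ∖ ｛ v ｝) → y ∈ component (C ∖ ｛ v ｝) x →
                   z ∈ ⟦ trace (cut v v∈C sub) y ⟧ → v ≢ z → z ∈ ⟦ trace (below x∈) y ⟧
    ∈trace-below x∈ y∈x z∈ v≢z with subst (λ ts → _ ∈ ⟦ ts ⟧) (trace-below x∈ y∈x) z∈
    ... | here refl = ⊥-elim (v≢z refl)
    ... | there z∈′ = z∈′

    ∈trace-above : ∀ {x y z} (x∈ : x ∈ C ∖ ｛ v ｝) → y ∈ component (C ∖ ｛ v ｝) x →
                   z ∈ ⟦ trace (below x∈) y ⟧ → z ∈ ⟦ trace (cut v v∈C sub) y ⟧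
    ∈trace-above x∈ y∈x z∈ = subst (λ ts → _ ∈ ⟦ ts ⟧) (sym (trace-below x∈ y∈x)) (there z∈)

    cut∈trace : ∀ {x} → x ∈ C → v ∈ ⟦ trace (cut v v∈C sub) x ⟧
    cut∈trace x∈C with cut-cases x∈C
    ... | inj₁ refl = subst (λ ts → v ∈ ⟦ ts ⟧) (sym trace-cut) (here refl)
    ... | inj₂ x∈ = subst (λ ts → v ∈ ⟦ ts ⟧) (sym (trace-below x∈ (component-refl x∈))) (here refl)

    component-rep : ∀ {x y} → x ∈ C ∖ ｛ v ｝ → y ∈ component (C ∖ ｛ v ｝) x →
                    y ∈ component (C ∖ ｛ v ｝) (rep (C ∖ ｛ v ｝) x)
    component-rep x∈ y∈x = component-trans (∈component-rep (C ∖ ｛ v ｝) x∈) y∈x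

  trace-⊆ : ∀ {C} (g : Decomposable C) {x} → x ∈ C → ⟦ trace g x ⟧ ⊆ C
  trace-⊆ (leaf _) x∈C ()
  trace-⊆ {C} (cut v v∈C sub) x∈C z∈ with cut-cases v∈C sub x∈C
  ... | inj₁ refl with subst (λ ts → _ ∈ ⟦ ts ⟧) (trace-cut v∈C sub) z∈
  ... | here refl = v∈C
  trace-⊆ {C} (cut v v∈C sub) x∈C z∈ | inj₂ x∈
    with subst (λ ts → _ ∈ ⟦ ts ⟧) (trace-below v∈C sub x∈ (component-refl x∈)) z∈
  ... | here refl = v∈C
  ... | there z∈′ = proj₁ (component-⊆
    (trace-⊆ (sub _ (rep∈ (C ∖ ｛ v ｝) x∈)) (∈component-rep (C ∖ ｛ v ｝) x∈) z∈′))

  trace-⊆-component : ∀ {C v} (v∈C : v ∈ C) sub {x z} → x ∈ C ∖ ｛ v ｝ → v ≢ z →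
    z ∈ ⟦ trace (cut v v∈C sub) x ⟧ → z ∈ component (C ∖ ｛ v ｝) x
  trace-⊆-component v∈C sub x∈ v≢z z∈ = component-trans (rep∈component _ x∈)
    (trace-⊆ (below v∈C sub x∈) (∈component-rep _ x∈)
      (∈trace-below v∈C sub x∈ (component-refl x∈) z∈ v≢z))

  trace-parent : ∀ {C} (g : Decomposable C) {x} → x ∈ C → x ∈ Vertex g →
    trace g x ≡ [ x ] ⊎ ∃[ y ] (y ∈ C × y ∈ Vertex g × trace g x ≡ trace g y ∷ʳ x)
  trace-parent (leaf _) x∈C ()
  trace-parent {C} (cut v v∈C sub) {x} x∈C x∈V with cut-cases v∈C sub x∈C
  ... | inj₁ refl = inj₁ (trace-cut v∈C sub)
  ... | inj₂ x∈
    with trace-parent (sub _ (rep∈ (C ∖ ｛ v ｝) x∈)) (∈component-rep (C ∖ ｛ v ｝) x∈)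
           (∈trace-below v∈C sub x∈ (component-refl x∈) x∈V (proj₂ x∈))
  ... | inj₁ t = inj₂ (v , v∈C , cut∈trace v∈C sub v∈C ,
    trans (trace-below v∈C sub x∈ (component-refl x∈))
      (trans (cong (v ∷_) t) (cong (_∷ʳ x) (sym (trace-cut v∈C sub)))))
  ... | inj₂ (y , y∈ , y∈V , t) =
    inj₂ (y , proj₁ (component-⊆ y∈) , ∈trace-above v∈C sub x∈ y∈x y∈V ,
      trans (trace-below v∈C sub x∈ (component-refl x∈))
        (trans (cong (v ∷_) t) (cong (_∷ʳ x) (sym (trace-below v∈C sub x∈ y∈x)))))
    where
    y∈x = component-trans (rep∈component (C ∖ ｛ v ｝) x∈) y∈

  module _ {C D : Pred S ℓ} {v : S} (conn : Connected D) (D⊆C : D ⊆ C) (v∉D : v ∉ D) where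

    uncut : D ⊆ C ∖ ｛ v ｝
    uncut x∈D = D⊆C x∈D , λ { refl → v∉D x∈D }

    uncut-⊆-component : ∀ {x} → x ∈ D → D ⊆ component (C ∖ ｛ v ｝) x
    uncut-⊆-component x∈D = connected⇒⊆-component conn uncut x∈D (component-refl (uncut x∈D))

  -- While no cut vertex lies in `D`, the set `D` stays in one component and its points share their
  -- traces so far. The first cut vertex in `D` is the common one; it exists since `x` itself gets
  -- cut.
  trace-meet : ∀ {C} (g : Decomposable C) {D : Pred S ℓ} → Connected D → D ⊆ C →
    ∀ {x y} → x ∈ D → y ∈ D → x ∈ Vertex g →
    ∃[ w ] (w ∈ D × w ∈ ⟦ trace g x ⟧ × w ∈ ⟦ trace g y ⟧)
  trace-meet (leaf _) conn D⊆C x∈D y∈D ()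
  trace-meet {C} (cut v v∈C sub) {D} conn D⊆C x∈D y∈D x∈V with em₀ {v ∈ D}
  ... | yes v∈D = v , v∈D , cut∈trace v∈C sub (D⊆C x∈D) , cut∈trace v∈C sub (D⊆C y∈D)
  ... | no v∉D =
    let x∈ = uncut conn D⊆C v∉D x∈D
        D⊆x = uncut-⊆-component conn D⊆C v∉D x∈D
        w , w∈D , w∈x , w∈y =
          trace-meet (sub _ (rep∈ (C ∖ ｛ v ｝) x∈)) conn (λ z∈ → component-rep v∈C sub x∈ (D⊆x z∈)) x∈D y∈D
            (∈trace-below v∈C sub x∈ (component-refl x∈) x∈V (proj₂ x∈))
    in w , w∈D , ∈trace-above v∈C sub x∈ (component-refl x∈) w∈x , ∈trace-above v∈C sub x∈ (D⊆x y∈D) w∈y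

  -- A connected set that loses no vertex stays in one component at each cut, down to a leaf.
  avoiding⇒captured : ∀ {C} (g : Decomposable C) {D : Pred S ℓ} → Connected D → Satisfiable D → D ⊆ C →
    (∀ {x} → x ∈ D → x ∉ Vertex g) → Captured D
  avoiding⇒captured (leaf (N , K , isK , C⊆K)) conn sat D⊆C avoid = N , K , isK , λ x∈ → C⊆K (D⊆C x∈)
  avoiding⇒captured {C} (cut v v∈C sub) {D} conn (d , d∈D) D⊆C avoid =
    avoiding⇒captured (sub _ (rep∈ (C ∖ ｛ v ｝) d∈)) conn (d , d∈D)
      (λ x∈ → component-rep v∈C sub d∈ (D⊆d x∈))
      (λ x∈ x∈V → avoid x∈ (∈trace-above v∈C sub d∈ (D⊆d x∈) x∈V))
    where
    v∉D : v ∉ D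
    v∉D v∈D = avoid v∈D (cut∈trace v∈C sub v∈C)
    d∈ = uncut conn D⊆C v∉D d∈D
    D⊆d = uncut-⊆-component conn D⊆C v∉D d∈D

  -- `D` is the set from which `x` gets deleted: connected, still containing `y`, and already
  -- without the vertices deleted before `x`.
  trace-join : ∀ {C} (g : Decomposable C) → Connected C →
    ∀ {x y} → x ∈ C → y ∈ C → x ∈ Vertex g → x ∈ ⟦ trace g y ⟧ →
    Σ[ D ∈ Pred S ℓ ] (Connected D × D ⊆ C × x ∈ D × y ∈ D ×
      (∀ {z} → z ∈ D → z ∈ ⟦ trace g x ⟧ → z ≡ x))
  trace-join (leaf _) conn x∈C y∈C ()
  trace-join {C} (cut v v∈C sub) conn {x} {y} x∈C y∈C x∈V x∈y with cut-cases v∈C sub x∈C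
  ... | inj₁ refl = C , conn , id , x∈C , y∈C , λ _ z∈ → only (subst (λ ts → _ ∈ ⟦ ts ⟧) (trace-cut v∈C sub) z∈)
    where
    only : ∀ {z} → z ∈ ⟦ [ v ] ⟧ → z ≡ v
    only (here z≡v) = z≡v
  ... | inj₂ x∈@(_ , v≢x) with cut-cases v∈C sub y∈C
  ... | inj₁ refl with subst (λ ts → x ∈ ⟦ ts ⟧) (trace-cut v∈C sub) x∈y
  ... | here refl = ⊥-elim (v≢x refl)
  trace-join {C} (cut v v∈C sub) conn {x} {y} x∈C y∈C x∈V x∈y | inj₂ x∈@(_ , v≢x) | inj₂ y∈ =
    let y∈x = component-sym (trace-⊆-component v∈C sub y∈ v≢x x∈y)
        D , conn-D , D⊆ , x∈D , y∈D , sole =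
          trace-join (sub _ (rep∈ (C ∖ ｛ v ｝) x∈)) component-connected
            (∈component-rep (C ∖ ｛ v ｝) x∈) (component-rep v∈C sub x∈ y∈x)
            (∈trace-below v∈C sub x∈ (component-refl x∈) x∈V v≢x)
            (∈trace-below v∈C sub x∈ y∈x x∈y v≢x)
    in D , conn-D , (λ z∈D → proj₁ (component-⊆ (D⊆ z∈D))) , x∈D , y∈D , λ z∈D z∈x →
      sole z∈D (∈trace-below v∈C sub x∈ (component-refl x∈) z∈x (proj₂ (component-⊆ (D⊆ z∈D))))

  -- Induction on the decomposition: only `x 0` can be the first cut vertex, and all later terms lie
  -- in one component left by that cut.
  trace-wellfounded : ∀ {C} (g : Decomposable C) (x : ℕ → S) → (∀ n → x n ∈ C) →
    (∀ n → x n ∈ Vertex g) → ¬ (∀ n → trace g (x (ℕ.suc n)) ≡ trace g (x n) ∷ʳ x (ℕ.suc n))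
  trace-wellfounded (leaf _) x x∈C x∈V child with x∈V 0
  ... | ()
  trace-wellfounded {C} g@(cut v v∈C sub) x x∈C x∈V child =
    trace-wellfounded (sub _ (rep∈ (C ∖ ｛ v ｝) (inside 0))) (λ n → x (ℕ.suc n))
      (λ n → component-rep v∈C sub (inside 0) (linked n))
      (λ n → ∈trace-below v∈C sub (inside 0) (linked n) (x∈V (ℕ.suc n)) (proj₂ (inside n)))
      (λ n → proj₂ (∷-injective (trans (sym (trace-below v∈C sub (inside 0) (linked (ℕ.suc n))))
        (trans (child (ℕ.suc n)) (cong (_∷ʳ x (2 + n)) (trace-below v∈C sub (inside 0) (linked n)))))))
    where
    inside : ∀ n → x (ℕ.suc n) ∈ C ∖ ｛ v ｝
    -- The trace of `v` is a singleton, while that of `x (ℕ.suc n)` extends a nonempty trace.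
    inside n = x∈C (ℕ.suc n) , λ v≡x → [-]≢∷ʳ (trace g (x n)) (x∈V n)
      (trans (sym (trace-cut v∈C sub)) (trans (cong (trace g) v≡x) (child n)))

    linked : ∀ n → x (ℕ.suc n) ∈ component (C ∖ ｛ v ｝) (x 1)
    linked zero = component-refl (inside 0)
    linked (ℕ.suc n) = component-trans (linked n) (component-sym
      (trace-⊆-component v∈C sub (inside (ℕ.suc n)) (proj₂ (inside n))
        (subst (λ ts → x (ℕ.suc n) ∈ ⟦ ts ⟧) (sym (child (ℕ.suc n))) (∈-++⁺ˡ (x∈V (ℕ.suc n))))))

  -- Normality, raylessness and the remaining components.

  module FromDecomposition {C : Pred S ℓ} (everything : ∀ x → x ∈ C) (C-connected : Connected C)
    (g : Decomposable C) (root : S) (trace-root : trace g root ≡ [ root ])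
    (root∈trace : ∀ x → root ∈ ⟦ trace g x ⟧) where

    parent : ∀ {x} → x ∈ Vertex g → x ≡ root ⊎ ∃[ y ] (y ∈ Vertex g × trace g x ≡ trace g y ∷ʳ x)
    parent {x} x∈V with trace-parent g (everything x) x∈V
    ... | inj₂ (y , _ , y∈V , t) = inj₂ (y , y∈V , t)
    ... | inj₁ t with subst (λ ts → root ∈ ⟦ ts ⟧) t (root∈trace x)
    ... | here root≡x = inj₁ (sym root≡x)

    module T = TraceTree em₀ (Vertex g) (trace g) root (root∈trace root)
      trace-root parent

    rayless : RootedTree.Rayless T.tree
    rayless = T.rayless λ x → trace-wellfounded g x (λ _ → everything _)

    isNormal : IsNormal T.tree
    isNormal = record
      { isWeakNormal = record { meet = meet ; join = join }
      ; rays = λ R _ → ⊥-elim (rayless R) }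
      where
      open RootedTree T.tree using (_≤_; Incomparable; Down°)

      meet : (D : Pred S ℓ) → Connected D → ∀ {u v} → u ∈ D ∩ Vertex g → v ∈ D ∩ Vertex g →
        Incomparable u v → ∃[ w ] (w ∈ D × w ≤ u × w ≤ v)
      meet D conn-D (u∈D , u∈V) (v∈D , v∈V) _
        with trace-meet g conn-D (λ _ → everything _) u∈D v∈D u∈V
      ... | w , w∈D , w∈u , w∈v = w , w∈D , T.∈trace⇒≤ u∈V w∈u , T.∈trace⇒≤ v∈V w∈v

      join : ∀ {u v} → u ∈ Vertex g → v ∈ Vertex g → u ≤ v →
        Σ[ D ∈ Pred S ℓ ] (Connected D × u ∈ D × v ∈ D × D ⊥ᵖ Down° u)
      join u∈V _ u≤v with trace-join g C-connected (everything _) (everything _) u∈V (T.≤⇒∈trace u≤v)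
      ... | D , conn-D , _ , u∈D , v∈D , sole = D , conn-D , u∈D , v∈D ,
        λ { (z∈D , _ , z≤u , z≢u) → z≢u (sole z∈D (T.≤⇒∈trace z≤u)) }

    captured : ∀ (D : Pred S ℓ) → D ∈ 𝒦 (∁ (Vertex g)) → ∃[ K ] (K ∈ 𝒦* X × D ⊆ K)
    captured D D∈𝒦 with avoiding⇒captured g (𝒦.connected D∈𝒦) (𝒦.nonempty D∈𝒦) (λ _ → everything _) (𝒦.inside D∈𝒦)
    ... | N , K , isK , D⊆K = K , (endOf N , isK) , D⊆K

theorem1p3 : ∀ {ℓ} → ExcludedMiddle (suc ℓ) → AxiomOfChoice (suc ℓ) →
    {S : Set ℓ} (𝒮 : Connectoid S) → let open Theory 𝒮 in
    S → IsConnectedConnectoid →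
    (X : Func Ends (FiniteSubsets S)) →
    Σ[ T ∈ RootedTree {S = S} ]
    ( IsNormal T
    × RootedTree.Rayless T
    × (∀ (D : Pred S ℓ) → D ∈ 𝒦 (∁ (RootedTree.V T)) →
    ∃[ K ] (K ∈ 𝒦* X × D ⊆ K)))
theorem1p3 {ℓ} em ac {S} 𝒮 s₀ conn X =
  N.T.tree , N.isNormal , N.rayless , N.captured
  where
  open Theory 𝒮
  open Connectivity 𝒮
  open Decomposition em 𝒮 X
  open NormalTree em ac 𝒮 s₀ X

  -- A copy of `U` at level `ℓ`, where `Decomposable` takes its sets.
  whole : Pred S ℓ
  whole _ = Lift ℓ ⊤

  whole-connected : Connected whole
  whole-connected _ _ with conn tt tt
  ... | F , F∈ , _ , x∈ , y∈ = F , F∈ , (λ _ → lift tt) , x∈ , y∈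

  sub : ∀ x → .(x ∈ whole ∖ ｛ s₀ ｝) → Decomposable (component (whole ∖ ｛ s₀ ｝) x)
  sub x x∈ = decomposable-if-connected component-connected (x , component-refl (recompute em₀ x∈))

  -- A cut even if the whole set is captured, as the tree needs a root.
  g : Decomposable whole
  g = cut s₀ (lift tt) sub

  module N = FromDecomposition (λ _ → lift tt) whole-connected g s₀
    (trace-cut (lift tt) sub) (λ x → cut∈trace (lift tt) sub {x} (lift tt))
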